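{- Let $q$ be a prime power, let $n\geq 2$ be an integer and let $\mathcal{C}\subseteq\mathcal{F}_q(n)$ be a full flag code on $\mathbb{F}_q^n$. The number of distance vectors in $\mathcal{D}(d_f(\mathcal{C}),n)$ equals the number of Motzkin paths $p\in\mathcal{M}_n$ such that $A(p)=d_f(\mathcal{C})$, i.e. the value $T(n,d_f(\mathcal{C}))$.
   Context: Let $\mathbb{F}_q$ be the finite field with $q$ elements. A full flag on $\mathbb{F}_q^n$ is a sequence $\mathcal{F}=(\mathcal{F}_1,\dots,\mathcal{F}_{n-1})$ of $\mathbb{F}_q$-subspaces of $\mathbb{F}_q^n$ with $\mathcal{F}_1\subsetneq\cdots\subsetneq\mathcal{F}_{n-1}$ and $\dim \mathcal{F}_i=i$ for every $i$; the set of all full flags is the full flag variety $\mathcal{F}_q(n)$. For subspaces $\mathcal{U},\mathcal{V}$ of the same dimension $k$, the injection distance is $d_I(\mathcal{U},\mathcal{V})=k-\dim(\mathcal{U}\cap\mathcal{V})$. The distance vector of $\mathcal{F},\mathcal{F}'\in\mathcal{F}_q(n)$ is $\mathbf{d}(\mathcal{F},\mathcal{F}')=(d_I(\mathcal{F}_1,\mathcal{F}'_1),\dots,d_I(\mathcal{F}_{n-1},\mathcal{F}'_{n-1}))\in\mathbb{Z}^{n-1}$; the flag distance $d_f(\mathcal{F},\mathcal{F}')=\sum_{i=1}^{n-1} d_I(\mathcal{F}_i,\mathcal{F}'_i)$ is the sum of its components. Put $\mathcal{D}(d,n)=\{\mathbf{d}(\mathcal{F},\mathcal{F}') \mid \mathcal{F},\mathcal{F}'\in\mathcal{F}_q(n),\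 d_f(\mathcal{F},\mathcal{F}')=d\}$ (pairs with $\mathcal{F}=\mathcal{F}'$ are allowed). A full flag code on $\mathbb{F}_q^n$ is a nonempty subset $\mathcal{C}\subseteq\mathcal{F}_q(n)$. Its minimum distance is $d_f(\mathcal{C})=\min\{d_f(\mathcal{F},\mathcal{F}')\mid \mathcal{F},\mathcal{F}'\in\mathcal{C},\ \mathcal{F}\neq\mathcal{F}'\}$ if $|\mathcal{C}|\geq 2$, and $d_f(\mathcal{C})=0$ if $|\mathcal{C}|=1$. A Motzkin path of length $n$ is a lattice path in $\mathbb{Z}^2$ from $(0,0)$ to $(n,0)$ with steps $U=(1,1)$, $D=(1,-1)$, $H=(1,0)$ that never runs below the $x$-axis; $\mathcal{M}_n$ is the set of these. The area $A(p)$ of a Motzkin path $p$ is the area of the region above the $x$-axis and below $p$. $T(n,k)$ denotes the number of Motzkin paths of length $n$ and area $k$. -}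

module Defs where

open import Algebra.Apartness.Bundles using (HeytingField)
import Algebra.Definitions.RawMonoid as RawMonoidDefinitions
open import Algebra.Bundles.Raw using (RawMonoid)
open import Data.Fin.Base as Fin using (Fin; toℕ)
open import Data.Integer.Base as ℤ using (ℤ; 0ℤ; 1ℤ; -1ℤ; +_)
import Data.Integer.Properties as ℤ
open import Data.List.Base as List using (List; []; _∷_; length; filter; cartesianProductWith)
open import Data.List.Membership.Propositional using (_∈_)
open import Data.List.Relation.Unary.Unique.Propositional using (Unique)
open import Data.Nat.Base as ℕ using (ℕ; zero; suc; pred; _∸_)
open import Data.Nat.Primality using (Prime)
open import Data.Product.Base using (Σ-syntax; ∃-syntax; ∃₂; _×_; _,_)
open import Data.Rational.Base as ℚ using (ℚ; 0ℚ)
import Data.Rational.Properties as ℚ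
open import Data.Sum.Base using (_⊎_)
open import Data.Vec.Base as Vec using (Vec; []; _∷_; lookup; sum; last)
open import Data.Vec.Functional using (Vector)
open import Data.Vec.Relation.Unary.All using (All; all?)
open import Function.Bundles using (_⇔_; Inverse)
open import Level using (Level; _⊔_) renaming (suc to lsuc)
open import Relation.Binary.Bundles using (Setoid)
open import Relation.Binary.PropositionalEquality using (_≡_; setoid)
open import Relation.Nullary using (Dec; ¬_; _×-dec_)
open import Relation.Unary using (Pred; _⊂_; _≐_)

IsPrimePower : ℕ → Set
IsPrimePower q = ∃[ p ] ∃[ k ] Prime p × 1 ℕ.≤ k × q ≡ p ℕ.^ k

-- The predicate P on A (with elements compared by _≡_) holds for exactly N
-- elements.
HasCardinality : ∀ {a p} {A : Set a} → Pred A p → ℕ → Set (a ⊔ p)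
HasCardinality {A = A} P N =
  Σ[ xs ∈ List A ] Unique xs × (∀ x → x ∈ xs ⇔ P x) × length xs ≡ N

-- A HeytingField is nontrivial, and its apartness is tight and coincides with
-- invertibility of the difference; when the carrier is finite it is therefore
-- the same as a field in the usual sense.
module Flags {c ℓ₁ ℓ₂ : Level} (F : HeytingField c ℓ₁ ℓ₂) where

  open HeytingField F
    using (Carrier; _≈_; _+_; _*_; 0#; isEquivalence)

  scalarSetoid : Setoid c ℓ₁
  scalarSetoid = record { isEquivalence = isEquivalence }

  HasOrder : ℕ → Set (c ⊔ ℓ₁)
  HasOrder q = Inverse (setoid (Fin q)) scalarSetoid

  ∑ : ∀ {k} → Vector Carrier k → Carrier
  ∑ = RawMonoidDefinitions.sum +-rawMonoid
    where
    +-rawMonoid : RawMonoid c ℓ₁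
    +-rawMonoid = record { Carrier = Carrier ; _≈_ = _≈_ ; _∙_ = _+_ ; ε = 0# }

  Space : ℕ → Set c
  Space n = Vector Carrier n

  infix 4 _≈ᵥ_
  _≈ᵥ_ : ∀ {n} → Space n → Space n → Set ℓ₁
  v ≈ᵥ w = ∀ j → v j ≈ w j

  0ᵥ : ∀ {n} → Space n
  0ᵥ _ = 0#

  linComb : ∀ {n k} → Vector Carrier k → Vector (Space n) k → Space n
  linComb a b j = ∑ (λ i → a i * b i j)

  record Subspace (n : ℕ) : Set (lsuc (c ⊔ ℓ₁)) where
    field
      member : Pred (Space n) (c ⊔ ℓ₁)
      resp   : ∀ {v w} → v ≈ᵥ w → member v → member w
      0-mem  : member 0ᵥ
      +-mem  : ∀ {v w} → member v → member w → member (λ j → v j + w j)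
      *-mem  : ∀ a {v} → member v → member (λ j → a * v j)

  open Subspace public

  _∩_ : ∀ {n} → Subspace n → Subspace n → Subspace n
  U ∩ V = record
    { member = λ v → member U v × member V v
    ; resp   = λ { eq (u , v) → resp U eq u , resp V eq v }
    ; 0-mem  = 0-mem U , 0-mem V
    ; +-mem  = λ { (u , v) (u′ , v′) → +-mem U u u′ , +-mem V v v′ }
    ; *-mem  = λ { a (u , v) → *-mem U a u , *-mem V a v }
    }

  LinearlyIndependent : ∀ {n k} → Vector (Space n) k → Set (c ⊔ ℓ₁)
  LinearlyIndependent b = ∀ a → linComb a b ≈ᵥ 0ᵥ → ∀ i → a i ≈ 0#

  record IsBasis {n k} (W : Subspace n) (b : Vector (Space n) k) : Set (c ⊔ ℓ₁) where
    field
      inside      : ∀ i → member W (b i)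
      independent : LinearlyIndependent b
      spanning    : ∀ v → member W v → ∃[ a ] v ≈ᵥ linComb a b

  HasDim : ∀ {n} → Subspace n → ℕ → Set (c ⊔ ℓ₁)
  HasDim {n} W k = Σ[ b ∈ Vector (Space n) k ] IsBasis W b

  -- Dimension and everything derived from it are functional relations, written
  -- with the value as last argument. The subtraction never truncates, since
  -- U ∩ V is contained in U.
  InjectionDistance : ∀ {n} → Subspace n → Subspace n → ℕ → Set (c ⊔ ℓ₁)
  InjectionDistance U V d =
    ∃₂ λ k m → HasDim U k × HasDim V k × HasDim (U ∩ V) m × d ≡ k ∸ m

  -- The index i : Fin (pred n) stands for position toℕ i + 1 of the flag.
  record FullFlag (n : ℕ) : Set (lsuc (c ⊔ ℓ₁)) where
    field
      space  : Fin (pred n) → Subspace n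
      dim    : ∀ i → HasDim (space i) (suc (toℕ i))
      strict : ∀ {i j} → i Fin.< j → member (space i) ⊂ member (space j)

  open FullFlag public

  -- Equality of flags: subspaces are compared as sets of vectors.
  infix 4 _≋_
  _≋_ : ∀ {n} → FullFlag n → FullFlag n → Set (c ⊔ ℓ₁)
  f ≋ g = ∀ i → member (space f i) ≐ member (space g i)

  DistanceVector : ∀ {n} → FullFlag n → FullFlag n → Vec ℕ (pred n) → Set (c ⊔ ℓ₁)
  DistanceVector f g v = ∀ i → InjectionDistance (space f i) (space g i) (lookup v i)

  FlagDistance : ∀ {n} → FullFlag n → FullFlag n → ℕ → Set (c ⊔ ℓ₁)
  FlagDistance f g d = ∃[ v ] DistanceVector f g v × d ≡ sum v

  𝒟 : (d n : ℕ) → Pred (Vec ℕ (pred n)) (lsuc (c ⊔ ℓ₁))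
  𝒟 d n v = ∃₂ λ (f g : FullFlag n) → DistanceVector f g v × FlagDistance f g d

  record FullFlagCode (n : ℕ) (p : Level) : Set (lsuc (c ⊔ ℓ₁ ⊔ p)) where
    field
      codeword : Pred (FullFlag n) p
      respects : ∀ {f g} → f ≋ g → codeword f → codeword g
      nonempty : ∃[ f ] codeword f

  open FullFlagCode public

  -- The first alternative is the case of at least two codewords, the second
  -- that of exactly one.
  MinimumDistance : ∀ {n p} → FullFlagCode n p → ℕ → Set (lsuc (c ⊔ ℓ₁) ⊔ p)
  MinimumDistance C d =
    ( (∃₂ λ f g → codeword C f × codeword C g × ¬ (f ≋ g) × FlagDistance f g d)
    × (∀ f g → codeword C f → codeword C g → ¬ (f ≋ g) →
         ∀ e → FlagDistance f g e → d ℕ.≤ e) )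
    ⊎ ( (∀ f g → codeword C f → codeword C g → f ≋ g) × d ≡ 0 )

data Step : Set where
  U D H : Step

rise : Step → ℤ
rise U = 1ℤ
rise D = -1ℤ
rise H = 0ℤ

-- The ordinates of the successive lattice points of the path, starting at a.
heightsFrom : ∀ {n} → ℤ → Vec Step n → Vec ℤ (suc n)
heightsFrom a []      = a ∷ []
heightsFrom a (s ∷ p) = a ∷ heightsFrom (a ℤ.+ rise s) p

heights : ∀ {n} → Vec Step n → Vec ℤ (suc n)
heights = heightsFrom 0ℤ

IsMotzkin : ∀ {n} → Vec Step n → Set
IsMotzkin p = All (0ℤ ℤ.≤_) (heights p) × last (heights p) ≡ 0ℤ

isMotzkin? : ∀ {n} (p : Vec Step n) → Dec (IsMotzkin p)
isMotzkin? p = all? (0ℤ ℤ.≤?_) (heights p) ×-dec (last (heights p) ℤ.≟ 0ℤ)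

-- The area under a piecewise linear graph with the given ordinates at
-- consecutive integers: one trapezoid of width 1 per step.
trapezoids : ∀ {n} → Vec ℤ (suc n) → ℚ
trapezoids (a ∷ [])     = 0ℚ
trapezoids (a ∷ b ∷ hs) = (a ℤ.+ b) ℚ./ 2 ℚ.+ trapezoids (b ∷ hs)

area : ∀ {n} → Vec Step n → ℚ
area p = trapezoids (heights p)

stepSequences : ∀ n → List (Vec Step n)
stepSequences zero    = [] ∷ []
stepSequences (suc n) = cartesianProductWith _∷_ (U ∷ D ∷ H ∷ []) (stepSequences n)

motzkinPaths : ∀ n → List (Vec Step n)
motzkinPaths n = filter isMotzkin? (stepSequences n)

T : ℕ → ℕ → ℕ
T n k = length (filter (λ p → area p ℚ.≟ + k ℚ./ 1) (motzkinPaths n))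

{-# OPTIONS --safe #-}

-- Extend a distance vector by a zero at both ends. Passing from one index to
-- the next, the dimension of the intersection grows by 0, 1 or 2, so consecutive
-- entries differ by at most 1: they are the ordinates of a Motzkin path, and the
-- area below a path is the sum of its ordinates. Conversely, let u and v be the
-- numbers of up and down steps of a Motzkin path after its i-th lattice point.
-- The spans of the unit vectors with indices in [u , u + i) and in [v , v + i)
-- are the i-th spaces of two flags, and their intersection has dimension
-- i - (v - u), where v - u is the i-th ordinate.
module Submission where

open import Defs
open import Algebra.Apartness.Bundles using (HeytingField; HeytingCommutativeRing)
open import Algebra.Bundles using (CommutativeRing)
import Algebra.Properties.CommutativeMonoid.Sum as Sum
import Algebra.Properties.Ring as RingProperties
open import Data.Empty using (⊥-elim)
open import Data.Fin.Base using (Fin; zero; suc; toℕ; fromℕ<; combine; remQuot; finToFun; funToFin)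
import Data.Fin.Properties as Fin
open import Data.Integer.Base as ℤ using (ℤ; 0ℤ; +_; +≤+)
import Data.Integer.Properties as ℤ
import Data.Integer.Tactic.RingSolver as ℤ
open import Data.List.Base using (List; []; _∷_; map; filter)
open import Data.List.Membership.Propositional using (_∈_)
open import Data.List.Membership.Propositional.Properties
  using (∈-map⁺; ∈-map⁻; ∈-filter⁺; ∈-filter⁻; ∈-cartesianProductWith⁺)
open import Data.List.Properties using (length-map)
import Data.List.Relation.Unary.All as Allₗ
import Data.List.Relation.Unary.All.Properties as Allₗ
open import Data.List.Relation.Unary.AllPairs using ([]; _∷_)
open import Data.List.Relation.Unary.Any using (here; there)
open import Data.List.Relation.Unary.Unique.Propositional using (Unique)
import Data.List.Relation.Unary.Unique.Propositional.Properties as Unique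
open import Data.Nat.Base as ℕ using (ℕ; zero; suc; _∸_; _≤_; _<_; z≤n; s≤s)
open import Data.Nat.Primality using (prime⇒nonTrivial)
import Data.Nat.Properties as ℕ
open import Data.Nat.Tactic.RingSolver using (solve-∀)
open import Data.Product.Base using (∃; ∃-syntax; _×_; _,_; proj₁; proj₂)
import Data.Rational.Base as ℚ
import Data.Rational.Properties as ℚ
import Data.Rational.Unnormalised.Base as ℚᵘ
import Data.Rational.Unnormalised.Properties as ℚᵘ
open import Data.Vec.Base using (Vec; []; _∷_; lookup; sum; last)
open import Data.Vec.Functional using (Vector)
open import Data.Vec.Properties using (∷-injective; tabulate∘lookup; tabulate-cong)
open import Data.Vec.Relation.Unary.All using (All; []; _∷_)
open import Function.Base using (_∘_)
open import Function.Bundles using (Inverse; mk⇔)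
open import Level using (Level; _⊔_; Lift; lift)
open import Relation.Binary.PropositionalEquality as ≡ using (_≡_; _≢_; cong; cong₂; subst)
open import Relation.Nullary using (¬_; Dec; yes; no; contradiction; _×-dec_)
open import Relation.Unary using (_⊆_)

-- Motzkin paths as walks on the natural numbers.

module Motzkin where

  open import Data.Nat.Base using (pred; _+_; _*_)
  open import Data.Nat.Properties using
    (+-comm; +-identityʳ; +-suc; ≤-refl; ≤-trans; m≤n+m; +-monoˡ-≤; +-monoʳ-≤; n≤1+n; pred[n]≤n; module ≤-Reasoning)
  open ≡ using (refl; sym; trans; module ≡-Reasoning)

  private variable
    m n a d : ℕ

  -- The truncation of `pred` never occurs on a `Walk`, where `down` starts at a successor.
  move : Step → ℕ → ℕ
  move U = suc
  move D = pred
  move H = λ a → a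

  -- An inductive form of `IsMotzkin`: nonnegativity is built into the index, and `stop` forces the
  -- end at height zero. The initial height is arbitrary so that tails of walks are walks again.
  data Walk : ∀ {n} → ℕ → Vec Step n → Set where
    stop  : Walk 0 []
    up    : ∀ {n a} {p : Vec Step n} → Walk (suc a) p → Walk a (U ∷ p)
    down  : ∀ {n a} {p : Vec Step n} → Walk a p → Walk (suc a) (D ∷ p)
    level : ∀ {n a} {p : Vec Step n} → Walk a p → Walk a (H ∷ p)

  walk-tail : ∀ {s} {p : Vec Step n} → Walk a (s ∷ p) → Walk (move s a) p
  walk-tail (up w)    = w
  walk-tail (down w)  = w
  walk-tail (level w) = w

  rise-move : ∀ {s} {p : Vec Step n} → Walk a (s ∷ p) → + a ℤ.+ rise s ≡ + move s a
  rise-move {a = a} (up _)    = cong +_ (+-comm a 1)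
  rise-move         (down _)  = refl
  rise-move {a = a} (level _) = cong +_ (+-identityʳ a)

  heightsFrom-last : ∀ a s (p : Vec Step n) →
    last (heightsFrom a (s ∷ p)) ≡ last (heightsFrom (a ℤ.+ rise s) p)
  heightsFrom-last a s []      = refl
  heightsFrom-last a s (t ∷ p) = refl

  heightsFrom-head : ∀ {P : ℤ → Set} {a} (p : Vec Step n) → All P (heightsFrom a p) → P a
  heightsFrom-head []      (h ∷ _) = h
  heightsFrom-head (_ ∷ _) (h ∷ _) = h

  walk-heights : {p : Vec Step n} → Walk a p →
    All (0ℤ ℤ.≤_) (heightsFrom (+ a) p) × last (heightsFrom (+ a) p) ≡ 0ℤ
  walk-heights {p = []}    stop = +≤+ z≤n ∷ [] , refl
  walk-heights {a = a} {p = s ∷ p} w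
    rewrite heightsFrom-last (+ a) s p | rise-move w
    with nonneg , end ← walk-heights (walk-tail w) = +≤+ z≤n ∷ nonneg , end

  heights-walk : (p : Vec Step n) → All (0ℤ ℤ.≤_) (heightsFrom (+ a) p) →
    last (heightsFrom (+ a) p) ≡ 0ℤ → Walk a p
  heights-walk {a = zero}  []  _ _ = stop
  heights-walk {a = suc _} []  _ ()
  heights-walk {a = a} (U ∷ p) (_ ∷ nonneg) end
    rewrite heightsFrom-last (+ a) U p | +-comm a 1 = up (heights-walk p nonneg end)
  heights-walk {a = a} (H ∷ p) (_ ∷ nonneg) end
    rewrite heightsFrom-last (+ a) H p | +-identityʳ a = level (heights-walk p nonneg end)
  heights-walk {a = suc a} (D ∷ p) (_ ∷ nonneg) end
    rewrite heightsFrom-last (+ suc a) D p = down (heights-walk p nonneg end)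
  -- A step `D` from height zero reaches -1, the first ordinate of the rest, against nonnegativity.
  heights-walk {a = zero} (D ∷ p) (_ ∷ nonneg) end
    with () ← heightsFrom-head p nonneg

  -- The ordinates strictly between the first and the last lattice point.
  profile : ℕ → Vec Step (suc m) → Vec ℕ m
  profile a (_ ∷ [])        = []
  profile a (s ∷ p@(_ ∷ _)) = move s a ∷ profile (move s a) p

  walk-end : Walk a [] → a ≡ 0
  walk-end stop = refl

  -- The walks exclude the one ambiguity: from height zero, `D` and `H` both give zero under `move`.
  move-injective : ∀ {s t} {p p′ : Vec Step n} → Walk a (s ∷ p) → Walk a (t ∷ p′) →
    move s a ≡ move t a → s ≡ t
  move-injective (up _)    (up _)    _ = refl
  move-injective (down _)  (down _)  _ = refl
  move-injective (level _) (level _) _ = refl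
  move-injective (up _)    (down _)  ()
  move-injective (up _)    (level _) ()
  move-injective (down _)  (up _)    ()
  move-injective (down _)  (level _) ()
  move-injective (level _) (up _)    ()
  move-injective (level _) (down _)  ()

  -- Each ordinate determines the step that leads to it; the last step is determined because both
  -- walks end at height zero.
  profile-injective : {p p′ : Vec Step (suc m)} → Walk a p → Walk a p′ →
    profile a p ≡ profile a p′ → p ≡ p′
  profile-injective {p = s ∷ []} {t ∷ []} w w′ _ =
    cong (_∷ []) (move-injective w w′ (trans (walk-end (walk-tail w)) (sym (walk-end (walk-tail w′)))))
  profile-injective {p = s ∷ _ ∷ _} {t ∷ _ ∷ _} w w′ eq with ∷-injective eq
  ... | eq₁ , eq₂ with refl ← move-injective w w′ eq₁ =
    cong (s ∷_) (profile-injective (walk-tail w) (walk-tail w′) eq₂)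

  -- The area below a walk.

  half-+ : ∀ x y → + x ℚ./ 2 ℚ.+ + y ℚ./ 2 ≡ + (x + y) ℚ./ 2
  half-+ x y = ℚ.toℚᵘ-injective (begin
    ℚ.toℚᵘ (+ x ℚ./ 2 ℚ.+ + y ℚ./ 2)               ≈⟨ ℚ.toℚᵘ-homo-+ (+ x ℚ./ 2) (+ y ℚ./ 2) ⟩
    ℚ.toℚᵘ (+ x ℚ./ 2) ℚᵘ.+ ℚ.toℚᵘ (+ y ℚ./ 2)     ≈⟨ ℚᵘ.+-cong (ℚ.toℚᵘ-fromℚᵘ (half x)) (ℚ.toℚᵘ-fromℚᵘ (half y)) ⟩
    half x ℚᵘ.+ half y                             ≈⟨ ℚᵘ.*≡* (numerators (+ x) (+ y)) ⟩
    half (x + y)                                   ≈⟨ ℚ.toℚᵘ-fromℚᵘ (half (x + y)) ⟨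
    ℚ.toℚᵘ (+ (x + y) ℚ./ 2)                       ∎)
    where
    open import Relation.Binary.Reasoning.Setoid ℚᵘ.≃-setoid
    half : ℕ → ℚᵘ.ℚᵘ
    half z = ℚᵘ.mkℚᵘ (+ z) 1
    numerators : ∀ i j → (i ℤ.* + 2 ℤ.+ j ℤ.* + 2) ℤ.* + 2 ≡ (i ℤ.+ j) ℤ.* + 4
    numerators = ℤ.solve-∀

  trapezoids-∷ : ∀ a b (p : Vec Step n) →
    trapezoids (a ∷ heightsFrom b p) ≡ (a ℤ.+ b) ℚ./ 2 ℚ.+ trapezoids (heightsFrom b p)
  trapezoids-∷ a b []      = refl
  trapezoids-∷ a b (_ ∷ _) = refl

  -- In the doubled area each interior ordinate counts twice, as a side of two trapezoids; the first
  -- ordinate `a` counts once and the last is zero.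
  walk-area : {p : Vec Step (suc m)} → Walk a p →
    trapezoids (heightsFrom (+ a) p) ≡ + (a + 2 * sum (profile a p)) ℚ./ 2
  walk-area {a = a} {s ∷ []} w rewrite rise-move w | walk-end (walk-tail w) =
    ℚ.+-identityʳ (+ (a + 0) ℚ./ 2)
  walk-area {a = a} {s ∷ t ∷ p} w rewrite rise-move w = begin
    (+ (a + b) ℚ./ 2) ℚ.+ trapezoids (heightsFrom (+ b) (t ∷ p))  ≡⟨ cong ((+ (a + b) ℚ./ 2) ℚ.+_) (walk-area (walk-tail w)) ⟩
    (+ (a + b) ℚ./ 2) ℚ.+ (+ (b + 2 * S) ℚ./ 2)                   ≡⟨ half-+ (a + b) (b + 2 * S) ⟩
    + (a + b + (b + 2 * S)) ℚ./ 2                                 ≡⟨ cong (λ z → + z ℚ./ 2) (regroup a b S) ⟩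
    + (a + 2 * (b + S)) ℚ./ 2                                     ∎
    where
    open ≡-Reasoning
    b = move s a
    S = sum (profile b (t ∷ p))
    regroup : ∀ a b S → a + b + (b + 2 * S) ≡ a + 2 * (b + S)
    regroup = solve-∀

  half-double : ∀ S → + (2 * S) ℚ./ 2 ≡ + S ℚ./ 1
  half-double S = ℚ.fromℚᵘ-cong {ℚᵘ.mkℚᵘ (+ (2 * S)) 1} {ℚᵘ.mkℚᵘ (+ S) 0}
    (ℚᵘ.*≡* (trans (sym (ℤ.pos-* (2 * S) 1)) (trans (cong +_ (double S)) (ℤ.pos-* S 2))))
    where
    double : ∀ S → (2 * S) * 1 ≡ S * 2
    double = solve-∀

  /1-injective : ∀ x y → + x ℚ./ 1 ≡ + y ℚ./ 1 → x ≡ y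
  /1-injective x y eq with ℚ.fromℚᵘ-injective {ℚᵘ.mkℚᵘ (+ x) 0} {ℚᵘ.mkℚᵘ (+ y) 0} eq
  ... | ℚᵘ.*≡* eq′ = ℤ.+-injective (trans (sym (ℤ.*-identityʳ (+ x))) (trans eq′ (ℤ.*-identityʳ (+ y))))

  area-profile : {p : Vec Step (suc m)} → Walk 0 p → area p ≡ + sum (profile 0 p) ℚ./ 1
  area-profile {p = p} w = trans (walk-area w) (half-double (sum (profile 0 p)))

  -- Walks from vectors with close consecutive entries.

  Close : ℕ → ℕ → Set
  Close a b = a ≤ suc b × b ≤ suc a

  -- The index is the entry in front of the vector, and the base case compares the last entry with
  -- an appended zero. So `Chain 0 v` concerns `v` extended by a zero at both ends.
  data Chain : ∀ {m} → ℕ → Vec ℕ m → Set where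
    []  : ∀ {a} → Close a 0 → Chain a []
    _∷_ : ∀ {m a b} {v : Vec ℕ m} → Close a b → Chain b v → Chain a (b ∷ v)

  close-move : ∀ a b → Close a b →
    ∃[ s ] move s a ≡ b × (∀ {n} {p : Vec Step n} → Walk b p → Walk a (s ∷ p))
  close-move zero    zero          _ = H , refl , level
  close-move zero    (suc zero)    _ = U , refl , up
  close-move zero    (suc (suc b)) (_ , s≤s ())
  close-move (suc zero)    zero    _ = D , refl , down
  close-move (suc (suc a)) zero    (s≤s () , _)
  close-move (suc a) (suc b) (s≤s a≤ , s≤s b≤) with close-move a b (a≤ , b≤)
  ... | U , refl , _ = U , refl , up
  ... | H , refl , _ = H , refl , level
  close-move (suc (suc a)) (suc .a) (s≤s a≤ , s≤s b≤) | D , refl , _ = D , refl , down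
  -- Here `D` joins zero to zero only through the truncated `pred`; one level up, the step between
  -- equal heights is `H`.
  close-move (suc zero) (suc .zero) (s≤s a≤ , s≤s b≤) | D , refl , _ = H , refl , level

  chain-walk : ∀ {v : Vec ℕ m} → Chain a v → ∃[ p ] Walk a p × profile a p ≡ v
  chain-walk ([] close) with s , _ , extend ← close-move _ 0 close = s ∷ [] , extend stop , refl
  chain-walk (close ∷ chain)
    with s , refl , extend ← close-move _ _ close
    with t ∷ p , w , refl ← chain-walk chain = s ∷ t ∷ p , extend w , refl

  -- Indices are compared through `toℕ`, the form in which the dimensions of a flag present them.
  -- The case `m ≡ 0` covers the empty vector, where `a` meets the final zero directly.
  close⇒chain : (v : Vec ℕ m) →
    (∀ i → toℕ i ≡ 0 → Close a (lookup v i)) →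
    (∀ i j → toℕ j ≡ suc (toℕ i) → Close (lookup v i) (lookup v j)) →
    (∀ i → suc (toℕ i) ≡ m → Close (lookup v i) 0) →
    (m ≡ 0 → Close a 0) → Chain a v
  close⇒chain []      first next final empty = [] (empty refl)
  close⇒chain (b ∷ v) first next final empty = first zero refl ∷ close⇒chain v
    (λ i eq → next zero (suc i) (cong suc eq))
    (λ i j eq → next (suc i) (suc j) (cong suc eq))
    (λ i eq → final (suc i) (cong suc eq))
    -- If the tail is empty, `b` is the last entry and `final` applies to it.
    (λ eq → final zero (cong suc (sym eq)))

  -- Numbers of up and down steps after a lattice point.

  remaining : (Step → ℕ) → Vec Step n → ℕ → ℕ
  remaining ι []      _       = 0
  remaining ι (s ∷ p) zero    = ι s + remaining ι p zero
  remaining ι (s ∷ p) (suc i) = remaining ι p i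

  -- With `remaining-step` this makes the intervals [r , r + i), for r = `remaining ι p i`, nested:
  -- as `i` grows, the left end does not rise and the right end does not fall.
  remaining-decr : ∀ ι (p : Vec Step n) i → remaining ι p (suc i) ≤ remaining ι p i
  remaining-decr ι []          i       = ≤-refl
  remaining-decr ι (s ∷ [])    zero    = z≤n
  remaining-decr ι (s ∷ t ∷ p) zero    = m≤n+m _ (ι s)
  remaining-decr ι (s ∷ p)     (suc i) = remaining-decr ι p i

  remaining-step : ∀ ι → (∀ s → ι s ≤ 1) → (p : Vec Step n) → ∀ i →
    remaining ι p i ≤ suc (remaining ι p (suc i))
  remaining-step ι ι≤1 []          i       = z≤n
  remaining-step ι ι≤1 (s ∷ [])    zero    = +-monoˡ-≤ 0 (ι≤1 s)
  remaining-step ι ι≤1 (s ∷ t ∷ p) zero    = +-monoˡ-≤ _ (ι≤1 s)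
  remaining-step ι ι≤1 (s ∷ p)     (suc i) = remaining-step ι ι≤1 p i

  remaining-end : ∀ ι (p : Vec Step n) → remaining ι p n ≡ 0
  remaining-end ι []      = refl
  remaining-end ι (s ∷ p) = remaining-end ι p

  isU isD : Step → ℕ
  isU U = 1
  isU D = 0
  isU H = 0
  isD U = 0
  isD D = 1
  isD H = 0

  isU≤1 : ∀ s → isU s ≤ 1
  isU≤1 U = ≤-refl
  isU≤1 D = z≤n
  isU≤1 H = z≤n

  isD≤1 : ∀ s → isD s ≤ 1
  isD≤1 U = z≤n
  isD≤1 D = ≤-refl
  isD≤1 H = z≤n

  walk-balance : {p : Vec Step n} → Walk a p → a + remaining isU p 0 ≡ remaining isD p 0
  walk-balance stop              = refl
  walk-balance {a = a} (up w)    = trans (+-suc a _) (walk-balance w)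
  walk-balance         (down w)  = cong suc (walk-balance w)
  walk-balance         (level w) = walk-balance w

  -- This is `walk-balance` for the rest of the walk after an interior lattice point. The ordinate
  -- there becomes the shift between the two intervals.
  profile-balance : {p : Vec Step (suc m)} → Walk a p → ∀ i →
    lookup (profile a p) i + remaining isU p (suc (toℕ i)) ≡ remaining isD p (suc (toℕ i))
  profile-balance {p = s ∷ _ ∷ _} w zero    = walk-balance (walk-tail w)
  profile-balance {p = s ∷ _ ∷ _} w (suc i) = profile-balance (walk-tail w) i

  move≤suc : ∀ s a → move s a ≤ suc a
  move≤suc U a = ≤-refl
  move≤suc D a = ≤-trans (pred[n]≤n {a}) (n≤1+n a)
  move≤suc H a = n≤1+n a

  -- For `a = 0` this keeps the shift between the two intervals within their common length.
  profile-bound : ∀ a (p : Vec Step (suc m)) i → lookup (profile a p) i ≤ suc (toℕ i) + a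
  profile-bound a (s ∷ _ ∷ _) zero    = move≤suc s a
  profile-bound a (s ∷ p@(_ ∷ _)) (suc i) = begin
    lookup (profile (move s a) p) i   ≤⟨ profile-bound (move s a) p i ⟩
    suc (toℕ i) + move s a            ≤⟨ +-monoʳ-≤ (suc (toℕ i)) (move≤suc s a) ⟩
    suc (toℕ i) + suc a               ≡⟨ +-suc (suc (toℕ i)) a ⟩
    suc (suc (toℕ i)) + a             ∎
    where open ≤-Reasoning

  -- Listing Motzkin paths of given area and their profiles.

  stepSequences-complete : (p : Vec Step n) → p ∈ stepSequences n
  stepSequences-complete []      = here refl
  stepSequences-complete (s ∷ p) = ∈-cartesianProductWith⁺ _∷_ (steps s) (stepSequences-complete p)
    where
    steps : ∀ s → s ∈ U ∷ D ∷ H ∷ []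
    steps U = here refl
    steps D = there (here refl)
    steps H = there (there (here refl))

  stepSequences-unique : ∀ n → Unique (stepSequences n)
  stepSequences-unique zero    = Allₗ.[] ∷ []
  stepSequences-unique (suc n) =
    Unique.cartesianProductWith⁺ _∷_ ∷-injective steps (stepSequences-unique n)
    where
    steps : Unique (U ∷ D ∷ H ∷ [])
    steps = ((λ ()) Allₗ.∷ (λ ()) Allₗ.∷ Allₗ.[]) ∷ ((λ ()) Allₗ.∷ Allₗ.[]) ∷ Allₗ.[] ∷ []

  -- Injectivity is asked only on the list, since `profile 0` is injective on walks but not on all
  -- step sequences.
  map-unique : ∀ {A B : Set} (f : A → B) (xs : List A) →
    (∀ {x y} → x ∈ xs → y ∈ xs → f x ≡ f y → x ≡ y) → Unique xs → Unique (map f xs)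
  map-unique f []       inj []         = []
  map-unique f (x ∷ xs) inj (x∉ ∷ uniq) =
    Allₗ.map⁺ (Allₗ.tabulate λ y∈ eq → Allₗ.lookup x∉ y∈ (inj (here refl) (there y∈) eq)) ∷
    map-unique f xs (λ x∈ y∈ → inj (there x∈) (there y∈)) uniq

  -- Its length is `T n d` by definition.
  paths : ℕ → ∀ n → List (Vec Step n)
  paths d n = filter (λ p → area p ℚ.≟ + d ℚ./ 1) (motzkinPaths n)

  paths-sound : {p : Vec Step (suc m)} → p ∈ paths d (suc m) → Walk 0 p × sum (profile 0 p) ≡ d
  paths-sound {m} {d} {p} p∈
    with p∈M , area≡d ← ∈-filter⁻ (λ p → area p ℚ.≟ + d ℚ./ 1) {xs = motzkinPaths (suc m)} p∈
    with _ , nonneg , end ← ∈-filter⁻ isMotzkin? {xs = stepSequences (suc m)} p∈M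
    = w , /1-injective _ d (trans (sym (area-profile w)) area≡d)
    where w = heights-walk p nonneg end

  paths-complete : {p : Vec Step (suc m)} → Walk 0 p → sum (profile 0 p) ≡ d → p ∈ paths d (suc m)
  paths-complete {d = d} {p} w refl =
    ∈-filter⁺ (λ p → area p ℚ.≟ + d ℚ./ 1)
      (∈-filter⁺ isMotzkin? (stepSequences-complete p) (walk-heights w)) (area-profile w)

  profiles : ℕ → ∀ m → List (Vec ℕ m)
  profiles d m = map (profile 0) (paths d (suc m))

  profiles-unique : ∀ d m → Unique (profiles d m)
  profiles-unique d m = map-unique (profile 0) (paths d (suc m))
    (λ x∈ y∈ → profile-injective (proj₁ (paths-sound {d = d} x∈)) (proj₁ (paths-sound {d = d} y∈)))
    (Unique.filter⁺ (λ p → area p ℚ.≟ + d ℚ./ 1)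
      (Unique.filter⁺ isMotzkin? (stepSequences-unique (suc m))))

  profiles-sound : {v : Vec ℕ m} → v ∈ profiles d m → ∃[ p ] Walk 0 p × profile 0 p ≡ v × sum v ≡ d
  profiles-sound v∈ with p , p∈ , refl ← ∈-map⁻ (profile 0) v∈
    with w , eq ← paths-sound p∈ = p , w , refl , eq

  profiles-complete : {v : Vec ℕ m} → Chain 0 v → sum v ≡ d → v ∈ profiles d m
  profiles-complete chain eq with p , w , refl ← chain-walk chain =
    ∈-map⁺ (profile 0) (paths-complete w eq)

open Motzkin

-- Counting in finite sets.

module _ {a b c : ℕ} (f : Fin a → Fin b)
  (g : ∀ x₀ x → f x₀ ≡ f x → Fin c)
  (g-injective : ∀ x₀ {x y} (p : f x₀ ≡ f x) (r : f x₀ ≡ f y) → g x₀ x p ≡ g x₀ y r → x ≡ y)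
  where

  private
    fibre? : ∀ z → Dec (∃ λ x₀ → f x₀ ≡ z)
    fibre? z = Fin.any? (λ x₀ → f x₀ Fin.≟ z)

    -- The base point comes from the search for a preimage of `z`, so all elements of one fibre are
    -- labelled relative to the same point.
    label : ∀ {z} → Dec (∃ λ x₀ → f x₀ ≡ z) → ∀ x → f x ≡ z → Fin c
    label (yes (x₀ , p)) x eq = g x₀ x (≡.trans p (≡.sym eq))
    label (no empty)     x eq = ⊥-elim (empty (x , eq))

    label-injective : ∀ {z} (δ : Dec (∃ λ x₀ → f x₀ ≡ z)) {x y} (p : f x ≡ z) (r : f y ≡ z) →
      label δ x p ≡ label δ y r → x ≡ y
    label-injective (yes (x₀ , _)) p r eq = g-injective x₀ _ _ eq
    label-injective (no empty)     p r eq = ⊥-elim (empty (_ , p))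

    encode : Fin a → Fin (b ℕ.* c)
    encode x = combine (f x) (label (fibre? (f x)) x ≡.refl)

    encode-injective : ∀ {x y} → encode x ≡ encode y → x ≡ y
    encode-injective {x} {y} eq with Fin.combine-injective (f x) _ (f y) _ eq
    ... | eq₁ , eq₂ = compare eq₁ ≡.refl ≡.refl eq₂
      where
      -- With the two values generalised, their equality can be matched on, and both labels then use
      -- one base point.
      compare : ∀ {z z′} → z ≡ z′ → (p : f x ≡ z) (r : f y ≡ z′) →
        label (fibre? z) x p ≡ label (fibre? z′) y r → x ≡ y
      compare {z} ≡.refl = label-injective (fibre? z)

  -- An element is determined by its image under `f` together with its label within the fibre.
  fibre-bound : a ≤ b ℕ.* c
  fibre-bound = Fin.injective⇒≤ encode-injective

^-cancelˡ-≤ : ∀ q {m n} → 1 < q → q ℕ.^ m ≤ q ℕ.^ n → m ≤ n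
^-cancelˡ-≤ q 1<q le = ℕ.≮⇒≥ λ n<m → ℕ.<⇒≱ (ℕ.^-monoʳ-< q 1<q n<m) le

funToFin-cong : ∀ {m n} {f g : Fin m → Fin n} → (∀ i → f i ≡ g i) → funToFin f ≡ funToFin g
funToFin-cong {zero}  f≗g = ≡.refl
funToFin-cong {suc m} f≗g = cong₂ combine (f≗g zero) (funToFin-cong (f≗g ∘ suc))

finToFun-injective : ∀ {m n} {x y : Fin (m ℕ.^ n)} → 
  (∀ i → finToFun {m} {n} x i ≡ finToFun y i) → x ≡ y
finToFun-injective {m} {n} {x} {y} eq = begin
  x                               ≡⟨ Fin.funToFin-finToFin {n} {m} x ⟨
  funToFin (finToFun {m} {n} x)   ≡⟨ funToFin-cong {n} {m} eq ⟩
  funToFin (finToFun {m} {n} y)   ≡⟨ Fin.funToFin-finToFin {n} {m} y ⟩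
  y                               ∎
  where open ≡.≡-Reasoning

-- The last hypothesis is `m′ ≤ m + 2` in the form that the cardinality argument yields. It gives
-- the first inequality, and `m ≤ m′` gives the second.
close-codimensions : ∀ {a b k m m′} → a ℕ.+ m ≡ k → b ℕ.+ m′ ≡ suc k → m ≤ m′ →
  m′ ℕ.+ (k ℕ.+ k) ≤ (suc k ℕ.+ suc k) ℕ.+ m → Close a b
close-codimensions {a} {b} {k} {m} {m′} eq eq′ m≤m′ growth =
  ℕ.+-cancelʳ-≤ (suc m) a (suc b) (begin
    a ℕ.+ suc m          ≡⟨ ℕ.+-suc a m ⟩
    suc (a ℕ.+ m)        ≡⟨ cong suc eq ⟩
    suc k                ≡⟨ eq′ ⟨
    b ℕ.+ m′             ≤⟨ ℕ.+-monoʳ-≤ b m′≤ ⟩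
    b ℕ.+ suc (suc m)    ≡⟨ ℕ.+-suc b (suc m) ⟩
    suc b ℕ.+ suc m      ∎) ,
  ℕ.+-cancelʳ-≤ m b (suc a) (begin
    b ℕ.+ m              ≤⟨ ℕ.+-monoʳ-≤ b m≤m′ ⟩
    b ℕ.+ m′             ≡⟨ eq′ ⟩
    suc k                ≡⟨ cong suc eq ⟨
    suc a ℕ.+ m          ∎)
  where
  open ℕ.≤-Reasoning
  regroup : ∀ k m → (suc k ℕ.+ suc k) ℕ.+ m ≡ suc (suc m) ℕ.+ (k ℕ.+ k)
  regroup = solve-∀
  m′≤ : m′ ≤ suc (suc m)
  m′≤ = ℕ.+-cancelʳ-≤ (k ℕ.+ k) m′ (suc (suc m)) (subst (m′ ℕ.+ (k ℕ.+ k) ≤_) (regroup k m) growth)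

-- Linear combinations, bases and sums.

module LinearAlgebra {c ℓ₁ ℓ₂ : Level} (F : HeytingField c ℓ₁ ℓ₂) where

  open Flags F
  open CommutativeRing (HeytingCommutativeRing.commutativeRing (HeytingField.heytingCommutativeRing F)) hiding (zero)
  open RingProperties ring using (-1*x≈-x; +-cancelˡ; +-cancelʳ)
  open Sum +-commutativeMonoid using (∑-distrib-+; sum-cong-≋; sum-replicate-zero)
  open import Relation.Binary.Reasoning.Setoid setoid

  linComb-∈ : ∀ {n k} (W : Subspace n) (a : Vector Carrier k) (b : Vector (Space n) k) →
    (∀ i → member W (b i)) → member W (linComb a b)
  linComb-∈ {k = zero}  W a b b∈ = 0-mem W
  linComb-∈ {k = suc k} W a b b∈ =
    +-mem W (*-mem W (a zero) (b∈ zero)) (linComb-∈ W (a ∘ suc) (b ∘ suc) (b∈ ∘ suc))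

  linComb-cong : ∀ {n k} {a a′ : Vector Carrier k} (b : Vector (Space n) k) →
    (∀ i → a i ≈ a′ i) → linComb a b ≈ᵥ linComb a′ b
  linComb-cong b a≈a′ j = sum-cong-≋ (λ i → *-congʳ (a≈a′ i))

  linComb-+ : ∀ {n k} (a a′ : Vector Carrier k) (b : Vector (Space n) k) →
    ∀ j → linComb (λ i → a i + a′ i) b j ≈ linComb a b j + linComb a′ b j
  linComb-+ a a′ b j = begin
    ∑ (λ i → (a i + a′ i) * b i j)           ≈⟨ sum-cong-≋ (λ i → distribʳ (b i j) (a i) (a′ i)) ⟩
    ∑ (λ i → a i * b i j + a′ i * b i j)     ≈⟨ ∑-distrib-+ (λ i → a i * b i j) (λ i → a′ i * b i j) ⟩
    linComb a b j + linComb a′ b j           ∎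

  cancel-difference : ∀ x y → x + - y + y ≈ x
  cancel-difference x y = begin
    x + - y + y     ≈⟨ +-assoc x (- y) y ⟩
    x + (- y + y)   ≈⟨ +-congˡ (-‿inverseˡ y) ⟩
    x + 0#          ≈⟨ +-identityʳ x ⟩
    x               ∎

  independent-injective : ∀ {n k} {b : Vector (Space n) k} → LinearlyIndependent b →
    ∀ a a′ → linComb a b ≈ᵥ linComb a′ b → ∀ i → a i ≈ a′ i
  independent-injective {b = b} independent a a′ eq i = begin
    a i                     ≈⟨ cancel-difference (a i) (a′ i) ⟨
    a i + - a′ i + a′ i     ≈⟨ +-congʳ (independent difference vanishes i) ⟩
    0# + a′ i               ≈⟨ +-identityˡ (a′ i) ⟩
    a′ i                    ∎
    where
    difference = λ i → a i + - a′ i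
    vanishes : linComb difference b ≈ᵥ 0ᵥ
    vanishes j = +-cancelʳ (linComb a′ b j) _ _ (begin
      linComb difference b j + linComb a′ b j  ≈⟨ linComb-+ difference a′ b j ⟨
      linComb (λ i → difference i + a′ i) b j  ≈⟨ linComb-cong b (λ i → cancel-difference (a i) (a′ i)) j ⟩
      linComb a b j                            ≈⟨ eq j ⟩
      linComb a′ b j                           ≈⟨ +-identityˡ _ ⟨
      0# + linComb a′ b j                      ∎)

  HasDim-resp : ∀ {n k} (V W : Subspace n) → member V ⊆ member W → member W ⊆ member V →
    HasDim V k → HasDim W k
  HasDim-resp V W V⊆W W⊆V (b , isBasis) = b , record
    { inside      = λ i → V⊆W (inside i)
    ; independent = independent
    ; spanning    = λ v v∈ → spanning v (W⊆V v∈)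
    }
    where open IsBasis isBasis

  ∑-zero : ∀ {k} (t : Vector Carrier k) → (∀ i → t i ≈ 0#) → ∑ t ≈ 0#
  ∑-zero {k} t t≈0 = trans (sum-cong-≋ t≈0) (sum-replicate-zero k)

  ∑-single : ∀ {k} (t : Vector Carrier k) i → (∀ j → j ≢ i → t j ≈ 0#) → ∑ t ≈ t i
  ∑-single t zero t≈0 = begin
    t zero + ∑ (t ∘ suc)   ≈⟨ +-congˡ (∑-zero (t ∘ suc) (λ j → t≈0 (suc j) λ ())) ⟩
    t zero + 0#            ≈⟨ +-identityʳ (t zero) ⟩
    t zero                 ∎
  ∑-single t (suc i) t≈0 = begin
    t zero + ∑ (t ∘ suc)   ≈⟨ +-cong (t≈0 zero λ ()) (∑-single (t ∘ suc) i λ j j≢i → t≈0 (suc j) (j≢i ∘ Fin.suc-injective)) ⟩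
    0# + t (suc i)         ≈⟨ +-identityˡ (t (suc i)) ⟩
    t (suc i)              ∎

  -- Spans of consecutive unit vectors.

  In : ℕ → ℕ → ℕ → Set
  In a k j = a ≤ j × j < a ℕ.+ k

  in? : ∀ a k j → Dec (In a k j)
  in? a k j = (a ℕ.≤? j) ×-dec (j ℕ.<? (a ℕ.+ k))

  -- The span of the unit vectors with indices in [a , a + k), described by the vanishing of all
  -- other coordinates. `Lift` adjusts the universe level to that of `member`.
  interval : ∀ {n} → ℕ → ℕ → Subspace n
  interval a k = record
    { member = λ v → Lift c (∀ j → ¬ In a k (toℕ j) → v j ≈ 0#)
    ; resp   = λ eq (lift v∈) → lift λ j j∉ → trans (sym (eq j)) (v∈ j j∉)
    ; 0-mem  = lift λ j j∉ → refl
    ; +-mem  = λ (lift v∈) (lift w∈) → lift λ j j∉ →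
                 trans (+-cong (v∈ j j∉) (w∈ j j∉)) (+-identityˡ 0#)
    ; *-mem  = λ a (lift v∈) → lift λ j j∉ → trans (*-congˡ (v∈ j j∉)) (zeroʳ a)
    }

  δ : ℕ → ℕ → Carrier
  δ x y with x ℕ.≟ y
  ... | yes _ = 1#
  ... | no  _ = 0#

  δ-refl : ∀ x → δ x x ≈ 1#
  δ-refl x with x ℕ.≟ x
  ... | yes _  = refl
  ... | no x≢x = contradiction ≡.refl x≢x

  δ-≢ : ∀ {x y} → x ≢ y → δ x y ≈ 0#
  δ-≢ {x} {y} x≢y with x ℕ.≟ y
  ... | yes x≡y = contradiction x≡y x≢y
  ... | no  _   = refl

  -- The basis consists of unit vectors. Evaluating a combination at `coordinate i` isolates its
  -- `i`-th coefficient, which gives independence and also the coefficients for spanning.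
  interval-dim : ∀ {n} a k → a ℕ.+ k ≤ n → HasDim (interval {n} a k) k
  interval-dim {n} a k a+k≤n = b , record
    { inside = λ i → lift λ j j∉ → δ-≢ λ eq → j∉ (subst (In a k) eq (position∈ i))
    ; independent = λ x eq i → trans (sym (coefficient x i)) (eq (coordinate i))
    ; spanning = λ v (lift v∈) → (v ∘ coordinate) , expand v v∈
    }
    where
    b : Vector (Space n) k
    b i j = δ (a ℕ.+ toℕ i) (toℕ j)

    position∈ : ∀ (i : Fin k) → In a k (a ℕ.+ toℕ i)
    position∈ i = ℕ.m≤m+n a (toℕ i) , ℕ.+-monoʳ-< a (Fin.toℕ<n i)

    position<n : ∀ (i : Fin k) → a ℕ.+ toℕ i < n
    position<n i = ℕ.<-≤-trans (proj₂ (position∈ i)) a+k≤n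

    coordinate : Fin k → Fin n
    coordinate i = fromℕ< (position<n i)

    coefficient : ∀ x i → linComb x b (coordinate i) ≈ x i
    coefficient x i = begin
      linComb x b (coordinate i)                          ≈⟨ ∑-single _ i (λ i′ i′≢i → trans (*-congˡ (δ-≢ (other i′ i′≢i))) (zeroʳ (x i′))) ⟩
      x i * δ (a ℕ.+ toℕ i) (toℕ (coordinate i))          ≡⟨ cong (λ z → x i * δ (a ℕ.+ toℕ i) z) (Fin.toℕ-fromℕ< (position<n i)) ⟩
      x i * δ (a ℕ.+ toℕ i) (a ℕ.+ toℕ i)                 ≈⟨ *-congˡ (δ-refl (a ℕ.+ toℕ i)) ⟩
      x i * 1#                                            ≈⟨ *-identityʳ (x i) ⟩
      x i                                                 ∎
      where
      other : ∀ i′ → i′ ≢ i → a ℕ.+ toℕ i′ ≢ toℕ (coordinate i)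
      other i′ i′≢i eq = i′≢i (Fin.toℕ-injective
        (ℕ.+-cancelˡ-≡ a _ _ (≡.trans eq (Fin.toℕ-fromℕ< (position<n i)))))

    expand : ∀ v → (∀ j → ¬ In a k (toℕ j) → v j ≈ 0#) → v ≈ᵥ linComb (v ∘ coordinate) b
    expand v v∈ j with in? a k (toℕ j)
    ... | no j∉ = trans (v∈ j j∉) (sym (∑-zero _ λ i →
            trans (*-congˡ (δ-≢ λ eq → j∉ (subst (In a k) eq (position∈ i)))) (zeroʳ (v (coordinate i)))))
    -- Inside the interval, `j` is `coordinate i` for the offset `i` = `toℕ j ∸ a`.
    ... | yes (a≤j , j<a+k) =
            subst (λ j → v j ≈ linComb (v ∘ coordinate) b j) eq (sym (coefficient (v ∘ coordinate) i))
      where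
      j∸a<k : toℕ j ∸ a < k
      j∸a<k = ℕ.+-cancelˡ-< a _ _ (subst (_< a ℕ.+ k) (≡.sym (ℕ.m+[n∸m]≡n a≤j)) j<a+k)
      i : Fin k
      i = fromℕ< j∸a<k
      eq : coordinate i ≡ j
      eq = Fin.toℕ-injective (≡.trans (Fin.toℕ-fromℕ< (position<n i))
             (≡.trans (cong (a ℕ.+_) (Fin.toℕ-fromℕ< j∸a<k)) (ℕ.m+[n∸m]≡n a≤j)))

  interval-mono : ∀ {n a k a′ k′} → a′ ≤ a → a ℕ.+ k ≤ a′ ℕ.+ k′ →
    member (interval {n} a k) ⊆ member (interval a′ k′)
  interval-mono a′≤a ≤a′+k′ (lift v∈) = lift λ j j∉ → v∈ j λ (a≤j , j<a+k) →
    j∉ (ℕ.≤-trans a′≤a a≤j , ℕ.<-≤-trans j<a+k ≤a′+k′)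

  interval-∩-dim : ∀ {n} a s k → a ℕ.+ (s ℕ.+ k) ≤ n →
    HasDim (interval {n} a (s ℕ.+ k) ∩ interval (a ℕ.+ s) (s ℕ.+ k)) k
  interval-∩-dim {n} a s k ≤n = HasDim-resp (interval (a ℕ.+ s) k) (I₁ ∩ I₂)
    (λ v∈ → interval-mono {n} {a ℕ.+ s} {k} (ℕ.m≤m+n a s) (ℕ.≤-reflexive end) v∈
          , interval-mono {n} {a ℕ.+ s} {k} ℕ.≤-refl (ℕ.+-monoʳ-≤ (a ℕ.+ s) (ℕ.m≤n+m k s)) v∈)
    (λ (lift v∈₁ , lift v∈₂) → lift λ j j∉ → meet v∈₁ v∈₂ j j∉)
    (interval-dim (a ℕ.+ s) k (subst (_≤ n) (≡.sym end) ≤n))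
    where
    I₁ I₂ : Subspace n
    I₁ = interval a (s ℕ.+ k)
    I₂ = interval (a ℕ.+ s) (s ℕ.+ k)
    end : a ℕ.+ s ℕ.+ k ≡ a ℕ.+ (s ℕ.+ k)
    end = ℕ.+-assoc a s k
    meet : ∀ {v : Space n} → (∀ j → ¬ In a (s ℕ.+ k) (toℕ j) → v j ≈ 0#) →
      (∀ j → ¬ In (a ℕ.+ s) (s ℕ.+ k) (toℕ j) → v j ≈ 0#) →
      ∀ j → ¬ In (a ℕ.+ s) k (toℕ j) → v j ≈ 0#
    -- An index outside the overlap misses the second interval if it is left of `a + s`; otherwise
    -- it misses the first, which ends where the overlap ends.
    meet v∈₁ v∈₂ j j∉ with (a ℕ.+ s) ℕ.≤? toℕ j
    ... | no  a+s≰j = v∈₂ j (a+s≰j ∘ proj₁)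
    ... | yes a+s≤j = v∈₁ j λ (_ , j<) → j∉ (a+s≤j , subst (toℕ j <_) (≡.sym end) j<)

  whole-dim : ∀ n → HasDim (interval {n} 0 n) n
  whole-dim n = interval-dim 0 n ℕ.≤-refl

  whole-top : ∀ {n} {v : Space n} → member (interval 0 n) v
  whole-top = lift λ j j∉ → contradiction (z≤n , Fin.toℕ<n j) j∉

  -- Cardinalities of subspaces over a finite field.

  record Enumeration {n} (W : Subspace n) (N : ℕ) : Set (c ⊔ ℓ₁) where
    field
      vec           : Fin N → Space n
      vec-∈         : ∀ x → member W (vec x)
      code          : ∀ {v} → member W v → Fin N
      vec-code      : ∀ {v} (v∈ : member W v) → vec (code v∈) ≈ᵥ v
      vec-injective : ∀ {x y} → vec x ≈ᵥ vec y → x ≡ y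

    code-injective : ∀ {v w} (v∈ : member W v) (w∈ : member W w) → code v∈ ≡ code w∈ → v ≈ᵥ w
    code-injective {v} {w} v∈ w∈ eq j = begin
      v j                ≈⟨ vec-code v∈ j ⟨
      vec (code v∈) j    ≡⟨ cong (λ x → vec x j) eq ⟩
      vec (code w∈) j    ≈⟨ vec-code w∈ j ⟩
      w j                ∎

  open Enumeration

  module Finite (q : ℕ) (1<q : 1 < q) (order : HasOrder q) where

    open Inverse order using (to; from; from-cong; strictlyInverseˡ; strictlyInverseʳ)

    to-injective : ∀ {x y} → to x ≈ to y → x ≡ y
    to-injective {x} {y} eq = ≡.trans (≡.sym (strictlyInverseʳ x))
      (≡.trans (from-cong eq) (strictlyInverseʳ y))

    -- Coordinates in a basis identify `W` with `k`-tuples of scalars, which `order` and `funToFin`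
    -- number.
    enumeration : ∀ {n k} (W : Subspace n) → HasDim W k → Enumeration W (q ℕ.^ k)
    enumeration {n} {k} W (b , isBasis) = record
      { vec           = λ x → linComb (scalars x) b
      ; vec-∈         = λ x → linComb-∈ W (scalars x) b inside
      ; code          = λ v∈ → funToFin (from ∘ proj₁ (spanning _ v∈))
      ; vec-code      = λ v∈ j → trans (linComb-cong b (scalars-code (proj₁ (spanning _ v∈))) j)
                                      (sym (proj₂ (spanning _ v∈) j))
      ; vec-injective = λ {x} {y} eq → finToFun-injective {q} {k} λ i →
          to-injective (independent-injective independent (scalars x) (scalars y) eq i)
      }
      where
      open IsBasis isBasis
      scalars : Fin (q ℕ.^ k) → Vector Carrier k
      scalars x i = to (finToFun {q} {k} x i)
      scalars-code : ∀ a i → scalars (funToFin (from ∘ a)) i ≈ a i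
      scalars-code a i = trans (reflexive (cong to (Fin.finToFun-funToFin (from ∘ a) i)))
                               (strictlyInverseˡ (a i))

    -- Dimensions are compared through cardinalities: `Y` injects into `W`, so `q ^ k ≤ q ^ m`, and
    -- `1 < q` allows passing to exponents.
    dim-mono : ∀ {n k m} (Y W : Subspace n) → HasDim Y k → HasDim W m → member Y ⊆ member W → k ≤ m
    dim-mono {k = k} {m} Y W dimY dimW Y⊆W = ^-cancelˡ-≤ q 1<q (Fin.injective⇒≤ injective)
      where
      EY = enumeration Y dimY
      EW = enumeration W dimW
      f : Fin (q ℕ.^ k) → Fin (q ℕ.^ m)
      f x = code EW (Y⊆W (vec-∈ EY x))
      injective : ∀ {x y} → f x ≡ f y → x ≡ y
      injective eq = vec-injective EY (code-injective EW _ _ eq)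

    dim-unique : ∀ {n k m} (W : Subspace n) → HasDim W k → HasDim W m → k ≡ m
    dim-unique W dim dim′ =
      ℕ.≤-antisym (dim-mono W W dim dim′ (λ w → w)) (dim-mono W W dim′ dim (λ w → w))

    difference-∈ : ∀ {n} (W : Subspace n) {v w : Space n} → member W v → member W w →
      member W (λ j → v j + - w j)
    difference-∈ W {v} {w} v∈ w∈ =
      resp W (λ j → +-congˡ (-1*x≈-x (w j))) (+-mem W v∈ (*-mem W (- 1#) w∈))

    -- When two sums agree, the difference of the first summands is a difference of the second ones,
    -- hence lies in any subspace containing these.
    swap-difference : ∀ x y x₀ y₀ → x₀ + y₀ ≈ x + y → y₀ + - y ≈ x + - x₀
    swap-difference x y x₀ y₀ eq = +-cancelˡ x₀ _ _ (begin
      x₀ + (y₀ + - y)   ≈⟨ +-assoc x₀ y₀ (- y) ⟨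
      x₀ + y₀ + - y     ≈⟨ +-congʳ eq ⟩
      x + y + - y       ≈⟨ +-assoc x y (- y) ⟩
      x + (y + - y)     ≈⟨ +-congˡ (-‿inverseʳ y) ⟩
      x + 0#            ≈⟨ +-identityʳ x ⟩
      x                 ≈⟨ cancel-difference x x₀ ⟨
      x + - x₀ + x₀     ≈⟨ +-comm (x + - x₀) x₀ ⟩
      x₀ + (x + - x₀)   ∎)

    -- The map (w , u , v) ↦ (w + u , w + v) from (X′ ∩ Y′) × X × Y to X′ × Y′
    -- is additive with kernel isomorphic to X ∩ Y; compare cardinalities.
    ∩-growth : ∀ {n k l m m′} (X Y X′ Y′ : Subspace n) →
      member X ⊆ member X′ → member Y ⊆ member Y′ →
      HasDim X k → HasDim Y k → HasDim X′ l → HasDim Y′ l →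
      HasDim (X ∩ Y) m → HasDim (X′ ∩ Y′) m′ → m′ ℕ.+ (k ℕ.+ k) ≤ (l ℕ.+ l) ℕ.+ m
    ∩-growth {n} {k} {l} {m} {m′} X Y X′ Y′ X⊆X′ Y⊆Y′ dimX dimY dimX′ dimY′ dim∩ dim∩′ =
      ^-cancelˡ-≤ q 1<q (as-powers (fibre-bound f g g-injective))
      where
      EX  = enumeration X dimX
      EY  = enumeration Y dimY
      EX′ = enumeration X′ dimX′
      EY′ = enumeration Y′ dimY′
      E   = enumeration (X ∩ Y) dim∩
      E′  = enumeration (X′ ∩ Y′) dim∩′

      K = q ℕ.^ k ℕ.* q ℕ.^ k
      Triple = Fin (q ℕ.^ m′ ℕ.* K)

      as-powers : q ℕ.^ m′ ℕ.* K ≤ (q ℕ.^ l ℕ.* q ℕ.^ l) ℕ.* q ℕ.^ m →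
        q ℕ.^ (m′ ℕ.+ (k ℕ.+ k)) ≤ q ℕ.^ ((l ℕ.+ l) ℕ.+ m)
      as-powers le rewrite ℕ.^-distribˡ-+-* q m′ (k ℕ.+ k) | ℕ.^-distribˡ-+-* q k k
        | ℕ.^-distribˡ-+-* q (l ℕ.+ l) m | ℕ.^-distribˡ-+-* q l l = le

      iʷ : Triple → Fin (q ℕ.^ m′)
      iʷ x = proj₁ (remQuot K x)
      iᵘ iᵛ : Triple → Fin (q ℕ.^ k)
      iᵘ x = proj₁ (remQuot {q ℕ.^ k} (q ℕ.^ k) (proj₂ (remQuot {q ℕ.^ m′} K x)))
      iᵛ x = proj₂ (remQuot {q ℕ.^ k} (q ℕ.^ k) (proj₂ (remQuot {q ℕ.^ m′} K x)))

      triple-injective : ∀ {x y} → iʷ x ≡ iʷ y → iᵘ x ≡ iᵘ y → iᵛ x ≡ iᵛ y → x ≡ y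
      triple-injective {x} {y} eqʷ eqᵘ eqᵛ = ≡.trans (≡.sym (rebuild x))
        (≡.trans (cong₂ combine eqʷ (cong₂ combine eqᵘ eqᵛ)) (rebuild y))
        where
        rebuild : ∀ x → combine (iʷ x) (combine (iᵘ x) (iᵛ x)) ≡ x
        rebuild x = ≡.trans
          (cong (combine (iʷ x)) (Fin.combine-remQuot {q ℕ.^ k} (q ℕ.^ k) (proj₂ (remQuot {q ℕ.^ m′} K x))))
          (Fin.combine-remQuot {q ℕ.^ m′} K x)

      w u v : Triple → Space n
      w x = vec E′ (iʷ x)
      u x = vec EX (iᵘ x)
      v x = vec EY (iᵛ x)

      w+u∈ : ∀ x → member X′ (λ j → w x j + u x j)
      w+u∈ x = +-mem X′ (proj₁ (vec-∈ E′ (iʷ x))) (X⊆X′ (vec-∈ EX (iᵘ x)))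

      w+v∈ : ∀ x → member Y′ (λ j → w x j + v x j)
      w+v∈ x = +-mem Y′ (proj₂ (vec-∈ E′ (iʷ x))) (Y⊆Y′ (vec-∈ EY (iᵛ x)))

      f : Triple → Fin (q ℕ.^ l ℕ.* q ℕ.^ l)
      f x = combine (code EX′ (w+u∈ x)) (code EY′ (w+v∈ x))

      f-fibre : ∀ x y → f x ≡ f y →
        (∀ j → w x j + u x j ≈ w y j + u y j) × (∀ j → w x j + v x j ≈ w y j + v y j)
      f-fibre x y eq with Fin.combine-injective (code EX′ (w+u∈ x)) _ (code EX′ (w+u∈ y)) _ eq
      ... | eq₁ , eq₂ = code-injective EX′ _ _ eq₁ , code-injective EY′ _ _ eq₂

      -- Within a fibre of `f`, the difference of the `w`-parts is a difference of `u`-parts, in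
      -- `X`, and of `v`-parts, in `Y`. Its code in `X ∩ Y` labels the point.
      w-w₀∈ : ∀ x₀ x → f x₀ ≡ f x → member (X ∩ Y) (λ j → w x j + - w x₀ j)
      w-w₀∈ x₀ x eq with eqᵘ , eqᵛ ← f-fibre x₀ x eq =
        resp X (λ j → swap-difference (w x j) (u x j) (w x₀ j) (u x₀ j) (eqᵘ j))
          (difference-∈ X (vec-∈ EX (iᵘ x₀)) (vec-∈ EX (iᵘ x))) ,
        resp Y (λ j → swap-difference (w x j) (v x j) (w x₀ j) (v x₀ j) (eqᵛ j))
          (difference-∈ Y (vec-∈ EY (iᵛ x₀)) (vec-∈ EY (iᵛ x)))

      g : ∀ x₀ x → f x₀ ≡ f x → Fin (q ℕ.^ m)
      g x₀ x eq = code E (w-w₀∈ x₀ x eq)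

      -- Equal labels give equal `w`-parts; equality of the sums then gives equal `u`-parts and
      -- `v`-parts.
      g-injective : ∀ x₀ {x y} (p : f x₀ ≡ f x) (r : f x₀ ≡ f y) → g x₀ x p ≡ g x₀ y r → x ≡ y
      g-injective x₀ {x} {y} p r eq = triple-injective
        (vec-injective E′ w≈) (vec-injective EX (λ j → cancel j (proj₁ same j)))
        (vec-injective EY (λ j → cancel j (proj₂ same j)))
        where
        same = f-fibre x y (≡.trans (≡.sym p) r)
        w≈ : w x ≈ᵥ w y
        w≈ j = +-cancelʳ (- w x₀ j) _ _ (code-injective E (w-w₀∈ x₀ x p) (w-w₀∈ x₀ y r) eq j)
        cancel : ∀ j {s t} → w x j + s ≈ w y j + t → s ≈ t
        cancel j eq = +-cancelˡ (w x j) _ _ (trans eq (+-congʳ (sym (w≈ j))))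

    -- Distance vectors are chains.

    injectionDistance-∸ : ∀ {n k d} (X Y : Subspace n) → HasDim X k →
      InjectionDistance X Y d → ∃[ m ] HasDim (X ∩ Y) m × d ℕ.+ m ≡ k
    injectionDistance-∸ X Y dim (k′ , m , dimX , _ , dim∩ , ≡.refl)
      with ≡.refl ← dim-unique X dim dimX =
      m , dim∩ , ℕ.m∸n+n≡m (dim-mono (X ∩ Y) X dim∩ dim proj₁)

    injectionDistance-unique : ∀ {n d d′} (X Y : Subspace n) →
      InjectionDistance X Y d → InjectionDistance X Y d′ → d ≡ d′
    injectionDistance-unique X Y (k , m , dimX , _ , dim∩ , ≡.refl) (k′ , m′ , dimX′ , _ , dim∩′ , ≡.refl) =
      cong₂ _∸_ (dim-unique X dimX dimX′) (dim-unique (X ∩ Y) dim∩ dim∩′)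

    -- The inclusion of the intersections gives one inequality, and `∩-growth` with `l = suc k`
    -- gives the other.
    close-distances : ∀ {n k a b} (X Y X′ Y′ : Subspace n) →
      member X ⊆ member X′ → member Y ⊆ member Y′ →
      HasDim X k → HasDim Y k → HasDim X′ (suc k) → HasDim Y′ (suc k) →
      InjectionDistance X Y a → InjectionDistance X′ Y′ b → Close a b
    close-distances X Y X′ Y′ X⊆X′ Y⊆Y′ dimX dimY dimX′ dimY′ dist dist′
      with m , dim∩ , eq ← injectionDistance-∸ X Y dimX dist
      with m′ , dim∩′ , eq′ ← injectionDistance-∸ X′ Y′ dimX′ dist′ =
      close-codimensions eq eq′
        (dim-mono (X ∩ Y) (X′ ∩ Y′) dim∩ dim∩′ (λ (x , y) → X⊆X′ x , Y⊆Y′ y))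
        (∩-growth X Y X′ Y′ X⊆X′ Y⊆Y′ dimX dimY dimX′ dimY′ dim∩ dim∩′)

    whole-distance : ∀ n → InjectionDistance (interval {n} 0 n) (interval {n} 0 n) 0
    whole-distance n = n , n , whole-dim n , whole-dim n ,
      HasDim-resp W (W ∩ W) (λ w → w , w) proj₁ (whole-dim n) , ≡.sym (ℕ.n∸n≡0 n)
      where
      W = interval {n} 0 n

    distanceVector-chain : ∀ {m} (f g : FullFlag (suc m)) v → DistanceVector f g v → Chain 0 v
    distanceVector-chain {m} f g v dist = close⇒chain v first next final (λ _ → z≤n , z≤n)
      where
      first : ∀ i → toℕ i ≡ 0 → Close 0 (lookup v i)
      -- The first spaces are lines, so their distance is at most one.
      first i i≡0 with m , _ , eq ← injectionDistance-∸ (space f i) (space g i) (dim f i) (dist i) =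
        z≤n , ℕ.≤-trans (ℕ.m≤m+n _ m) (ℕ.≤-reflexive (≡.trans eq (cong suc i≡0)))

      next : ∀ i j → toℕ j ≡ suc (toℕ i) → Close (lookup v i) (lookup v j)
      next i j j≡1+i = close-distances (space f i) (space g i) (space f j) (space g j)
        (proj₁ (strict f i<j)) (proj₁ (strict g i<j)) (dim f i) (dim g i)
        (subst (HasDim (space f j) ∘ suc) j≡1+i (dim f j))
        (subst (HasDim (space g j) ∘ suc) j≡1+i (dim g j))
        (dist i) (dist j)
        where
        i<j = ℕ.≤-reflexive (≡.sym j≡1+i)

      final : ∀ i → suc (toℕ i) ≡ m → Close (lookup v i) 0
      -- Both flags are continued by the whole space, which has the next dimension and is at
      -- distance zero from itself.
      final i 1+i≡m = close-distances (space f i) (space g i) W W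
        (λ _ → whole-top) (λ _ → whole-top) (dim f i) (dim g i)
        dimW dimW (dist i) (whole-distance (suc m))
        where
        W = interval {suc m} 0 (suc m)
        dimW : HasDim W (suc (suc (toℕ i)))
        dimW = subst (HasDim W) (cong suc (≡.sym 1+i≡m)) (whole-dim (suc m))

    distanceVector-unique : ∀ {n} (f g : FullFlag n) v w →
      DistanceVector f g v → DistanceVector f g w → v ≡ w
    distanceVector-unique f g v w dv dw = ≡.trans (≡.sym (tabulate∘lookup v))
      (≡.trans (tabulate-cong λ i → injectionDistance-unique (space f i) (space g i) (dv i) (dw i))
               (tabulate∘lookup w))

    -- `FlagDistance` brings a distance vector of its own, which uniqueness identifies with `v`.
    flagDistance-sum : ∀ {n d} (f g : FullFlag n) v →
      DistanceVector f g v → FlagDistance f g d → sum v ≡ d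
    flagDistance-sum f g v dv (w , dw , ≡.refl) = cong sum (distanceVector-unique f g v w dv dw)

    interval-distance : ∀ {n a b t s} → a ℕ.+ t ≤ n → b ℕ.+ t ≤ n → s ≤ t → a ℕ.+ s ≡ b →
      InjectionDistance (interval {n} a t) (interval b t) s
    interval-distance {a = a} {s = s} a+t≤n b+t≤n s≤t ≡.refl
      with k , ≡.refl ← ℕ.m≤n⇒∃[o]m+o≡n s≤t =
      s ℕ.+ k , k , interval-dim a (s ℕ.+ k) a+t≤n , interval-dim (a ℕ.+ s) (s ℕ.+ k) b+t≤n ,
      interval-∩-dim a s k a+t≤n , ≡.sym (ℕ.m+n∸n≡m s k)

    -- Flags of intervals that realise a Motzkin path.

    module IntervalFlag {n} (u : ℕ → ℕ) (u-decr : ∀ i → u (suc i) ≤ u i)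
      (u-step : ∀ i → u i ≤ suc (u (suc i))) (u-end : u n ≡ 0) where

      left-anti : ∀ {i j} → i ≤ j → u j ≤ u i
      left-anti = anti ∘ ℕ.≤⇒≤′
        where
        anti : ∀ {i j} → i ℕ.≤′ j → u j ≤ u i
        anti (ℕ.≤′-reflexive ≡.refl) = ℕ.≤-refl
        anti (ℕ.≤′-step i≤j)         = ℕ.≤-trans (u-decr _) (anti i≤j)

      -- Each step lowers the left end by at most one while the length grows by one.
      right-mono : ∀ {i j} → i ≤ j → u i ℕ.+ i ≤ u j ℕ.+ j
      right-mono = mono ∘ ℕ.≤⇒≤′
        where
        mono : ∀ {i j} → i ℕ.≤′ j → u i ℕ.+ i ≤ u j ℕ.+ j
        mono (ℕ.≤′-reflexive ≡.refl)   = ℕ.≤-refl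
        mono (ℕ.≤′-step {j} i≤j) = ℕ.≤-trans (mono i≤j) (ℕ.≤-trans
          (ℕ.+-monoˡ-≤ j (u-step j)) (ℕ.≤-reflexive (≡.sym (ℕ.+-suc (u (suc j)) j))))

      -- Since `u n` is zero, the right end at `n` is `n` itself and bounds all earlier ones.
      right≤n : ∀ {i} → i ≤ n → u i ℕ.+ i ≤ n
      right≤n {i} i≤n = subst (λ z → u i ℕ.+ i ≤ z ℕ.+ n) u-end (right-mono i≤n)

      position≤n : ∀ (i : Fin (ℕ.pred n)) → suc (toℕ i) ≤ n
      position≤n i = ℕ.≤-trans (Fin.toℕ<n i) (ℕ.pred[n]≤n {n})

      spaces : Fin (ℕ.pred n) → Subspace n
      spaces i = interval (u (suc (toℕ i))) (suc (toℕ i))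

      spaces-dim : ∀ i → HasDim (spaces i) (suc (toℕ i))
      spaces-dim i = interval-dim _ _ (right≤n (position≤n i))

      flag : FullFlag n
      flag = record
        { space  = spaces
        ; dim    = spaces-dim
        ; strict = λ {i} {j} i<j →
            interval-mono (left-anti (s≤s (ℕ.<⇒≤ i<j))) (right-mono (s≤s (ℕ.<⇒≤ i<j))) ,
            -- The reverse inclusion would force the larger dimension below the smaller one.
            λ ⊇ → ℕ.<⇒≱ i<j (ℕ.≤-pred (dim-mono (spaces j) (spaces i) (spaces-dim j) (spaces-dim i) ⊇))
        }

    module _ {m} (p : Vec Step (suc m)) (w : Walk 0 p) where

      private
        ups downs : ℕ → ℕ
        ups   = remaining isU p
        downs = remaining isD p

        module X = IntervalFlag {suc m} ups (remaining-decr isU p) (remaining-step isU isU≤1 p) (remaining-end isU p)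
        module Y = IntervalFlag {suc m} downs (remaining-decr isD p) (remaining-step isD isD≤1 p) (remaining-end isD p)

      -- By `profile-balance` the second interval is the first one shifted by the ordinate, and this
      -- shift is the distance because `profile-bound` keeps it within the length.
      walk-distanceVector : DistanceVector X.flag Y.flag (profile 0 p)
      walk-distanceVector i = interval-distance
        (X.right≤n (X.position≤n i)) (Y.right≤n (Y.position≤n i))
        (subst (lookup (profile 0 p) i ≤_) (ℕ.+-identityʳ (suc (toℕ i))) (profile-bound 0 p i))
        (≡.trans (ℕ.+-comm (ups (suc (toℕ i))) (lookup (profile 0 p) i)) (profile-balance w i))

      walk-∈𝒟 : 𝒟 (sum (profile 0 p)) (suc m) (profile 0 p)
      walk-∈𝒟 = X.flag , Y.flag , walk-distanceVector , profile 0 p , walk-distanceVector , ≡.refl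

    -- The number of distance vectors.

    𝒟-cardinality : ∀ d m → HasCardinality (𝒟 d (suc m)) (T (suc m) d)
    𝒟-cardinality d m = profiles d m , profiles-unique d m , (λ v → mk⇔ sound complete) ,
      length-map (profile 0) (paths d (suc m))
      where
      sound : ∀ {v} → v ∈ profiles d m → 𝒟 d (suc m) v
      sound v∈ with p , w , ≡.refl , ≡.refl ← profiles-sound {d = d} v∈ = walk-∈𝒟 p w

      complete : ∀ {v} → 𝒟 d (suc m) v → v ∈ profiles d m
      complete {v} (f , g , dv , fd) =
        profiles-complete (distanceVector-chain f g v dv) (flagDistance-sum f g v dv fd)

-- Comparing powers of `q` compares their exponents only when `q` exceeds one.
primePower>1 : ∀ {q} → IsPrimePower q → 1 < q
primePower>1 (p , k , p-prime , 1≤k , ≡.refl) =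
  ℕ.^-monoʳ-< p (ℕ.nonTrivial⇒n>1 p {{prime⇒nonTrivial p-prime}}) 1≤k

corollary4p19 : ∀ {c ℓ₁ ℓ₂ p : Level} (q : ℕ) → IsPrimePower q →
    (F : HeytingField c ℓ₁ ℓ₂) → Flags.HasOrder F q →
    (n : ℕ) → 2 ≤ n →
    (C : Flags.FullFlagCode F n p) →
    (d : ℕ) → Flags.MinimumDistance F C d →
    HasCardinality (Flags.𝒟 F d n) (T n d)
corollary4p19 q primePower F order (suc m) _ _ d _ =
  LinearAlgebra.Finite.𝒟-cardinality F q (primePower>1 primePower) order d m
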